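{- For every integer $g\ge0$ there exists a self-dual polyhedral map of genus $g$.
   Context: A polyhedral map is a 3-connected graph embedded in a closed orientable surface such that every face is an open disc and the closures of any two faces have connected intersection (equivalently, face-width at least 3); its genus is that of the surface. A map is self-dual if it is isomorphic (as a map) to its dual map. -}

module Defs where

open import Data.Fin.Base using (Fin)
open import Data.List.Base using (List; length)
import Data.List.Membership.Setoid as Membership
open import Data.Nat.Base using (ℕ; _+_; _*_; _<_)
open import Data.Product.Base using (_×_; ∃-syntax)
open import Data.Sum.Base using (_⊎_; inj₁; inj₂)
open import Function.Bundles using (Inverse; Injection; _↔_; mk↔ₛ′)
open import Function.Construct.Composition using (_↔-∘_)
open import Level using (0ℓ)
open import Relation.Binary.Bundles using (Setoid)
open import Relation.Binary.Core using (Rel)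
open import Relation.Binary.Construct.Closure.Equivalence as EqC using (EqClosure)
import Relation.Binary.Construct.Closure.ReflexiveTransitive as Star
open import Relation.Binary.PropositionalEquality
  using (_≡_; _≢_; refl; trans; cong; setoid)
open import Relation.Nullary.Negation using (¬_)

Orbits : {A : Set} → (A → A) → Setoid 0ℓ 0ℓ
Orbits f = EqC.setoid (λ x y → f x ≡ y)

HasCardinality : Setoid 0ℓ 0ℓ → ℕ → Set
HasCardinality S n = Inverse S (setoid (Fin n))

-- A connected graph with at least one edge, embedded in a closed oriented
-- surface so that all faces are open discs, given by its rotation system.
-- A dart is an edge with a direction; it starts at its tail.  σ turns a dart
-- to the next one counterclockwise around its tail, and α reverses a dart.
-- The surface is recovered by glueing one disc along each orbit of σ ∘ α.
-- The degenerate case without darts represents no surface; IsPolyhedral below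
-- rules it out by requiring four vertices.
record Map : Set₁ where
  field
    Dart         : Set
    size         : ℕ
    finite       : Dart ↔ Fin size
    σ            : Dart ↔ Dart
    α            : Dart → Dart
    α-involutive : ∀ d → α (α d) ≡ d
    α-free       : ∀ d → α d ≢ d

  rot : Dart → Dart
  rot = Inverse.to σ

  field
    connected : ∀ d e → EqClosure (λ x y → rot x ≡ y ⊎ α x ≡ y) d e

  reverse : Dart ↔ Dart
  reverse = mk↔ₛ′ α α α-involutive α-involutive

  -- Follows a dart to its head and there takes the next dart along the
  -- boundary of the face lying to its right.
  φ : Dart ↔ Dart
  φ = σ ↔-∘ reverse

  -- The dart d represents its tail, its underlying edge, and the face to
  -- its right, respectively.
  Vertices Edges Faces : Setoid 0ℓ 0ℓ
  Vertices = Orbits rot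
  Edges    = Orbits α
  Faces    = Orbits (Inverse.to φ)

  open Setoid Vertices public using () renaming (_≈_ to SameVertex)
  open Setoid Faces    public using () renaming (_≈_ to SameFace)

-- Euler's formula v - e + f = 2 - 2g, without subtraction.
HasGenus : ℕ → Map → Set
HasGenus g M = ∃[ v ] ∃[ e ] ∃[ f ]
    HasCardinality Vertices v
  × HasCardinality Edges e
  × HasCardinality Faces f
  × v + f + 2 * g ≡ e + 2
  where open Map M

-- Each face of M becomes a vertex, and d becomes the dart leaving the face to
-- the right of d across the edge of d.  Since φ runs clockwise around a face,
-- this is the dual drawn with the opposite orientation of the surface.
dual : Map → Map
dual M = record
  { Dart         = Dart
  ; size         = size
  ; finite       = finite
  ; σ            = φ
  ; α            = α
  ; α-involutive = α-involutive
  ; α-free       = α-free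
  ; connected    = λ d e → EqC.fold (EqC.isEquivalence Link) step (connected d e)
  }
  where
  open Map M

  Link : Rel Dart 0ℓ
  Link x y = Inverse.to φ x ≡ y ⊎ α x ≡ y

  step : ∀ {x y} → rot x ≡ y ⊎ α x ≡ y → EqClosure Link x y
  step {x} (inj₁ p) =
    EqC.return (inj₂ refl) Star.◅◅
    EqC.return (inj₁ (trans (cong rot (α-involutive x)) p))
  step     (inj₂ q) = EqC.return (inj₂ q)

-- Isomorphisms come from arbitrary homeomorphisms of the surfaces, so they
-- either preserve the rotation at every vertex or invert it at every vertex.
record _≅_ (M N : Map) : Set where
  private
    module M = Map M
    module N = Map N
  field
    bijection : M.Dart ↔ N.Dart

  to : M.Dart → N.Dart
  to = Inverse.to bijection

  field
    α-compatible : ∀ d → to (M.α d) ≡ N.α (to d)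
    σ-compatible : (∀ d → to (M.rot d) ≡ N.rot (to d))
                 ⊎ (∀ d → N.rot (to (M.rot d)) ≡ to d)

SelfDual : Map → Set
SelfDual M = M ≅ dual M

module _ (M : Map) where
  open Map M
  open Membership Vertices using (_∉_)

  -- No loops and no parallel edges.
  IsSimple : Set
  IsSimple = (∀ d → ¬ SameVertex d (α d))
           × (∀ d e → SameVertex d e → SameVertex (α d) (α e) → d ≡ e)

  -- Walks in the graph after deletion of the vertices represented in X.
  ConnectedAvoiding : List Dart → Rel Dart 0ℓ
  ConnectedAvoiding X =
    EqClosure (λ x y → x ∉ X × y ∉ X × (SameVertex x y ⊎ α x ≡ y))

  -- More than k vertices, and no fewer than k of them separate the graph.
  IsConnectedOfOrder : ℕ → Set
  IsConnectedOfOrder k =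
      Injection (setoid (Fin (1 + k))) Vertices
    × (∀ X → length X < k → ∀ d e → d ∉ X → e ∉ X → ConnectedAvoiding X d e)

  -- The tail of x, respectively the edge of x, lies in the closure of the
  -- face c.
  VertexOn EdgeOn : Dart → Dart → Set
  VertexOn c x = ∃[ y ] SameVertex x y × SameFace y c
  EdgeOn   c x = SameFace x c ⊎ SameFace (α x) c

  -- The closures of distinct faces c and d intersect in the subgraph of the
  -- vertices and edges lying on both; it may be empty.
  ConnectedIntersection : Dart → Dart → Set
  ConnectedIntersection c d =
    ∀ x y → VertexOn c x → VertexOn d x → VertexOn c y → VertexOn d y →
    EqClosure (λ u w → SameVertex u w ⊎ (α u ≡ w × EdgeOn c u × EdgeOn d u)) x y

  -- A face boundary is a cycle, meeting each vertex only once.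
  HasSimpleFaces : Set
  HasSimpleFaces = ∀ x y → SameFace x y → SameVertex x y → x ≡ y

  -- For a simple 3-connected graph on a surface of genus at least 1, the last
  -- two fields together say that the face-width is at least 3.  The last field
  -- alone does not: K₄ has a toroidal embedding with two faces, of lengths 4
  -- and 8, that intersect in a 4-cycle.
  record IsPolyhedral : Set where
    field
      simple       : IsSimple
      3-connected  : IsConnectedOfOrder 3
      simpleFaces  : HasSimpleFaces
      intersection : ∀ c d → ¬ SameFace c d → ConnectedIntersection c d

{-# OPTIONS --safe #-}

-- Take a self-dual polyhedron P with two vertices and two faces that are
-- pairwise far apart, and its cyclic (g + 1)-fold cover branched over these
-- four cells.  By Riemann–Hurwitz the cover has genus g.  Since branched cells
-- are far apart, near any meeting of two faces of the cover at most one cell is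
-- branched and the others determine the sheets; so two faces still meet in a
-- vertex or an edge at most, and this implies 3-connectedness.  A duality of P
-- that exchanges the branched vertices with the branched faces lifts.
module Submission where

open import Defs
open import Data.Bool.Base using (if_then_else_)
open import Data.Empty using (⊥)
open import Data.Fin.Base using (Fin; zero; suc; toℕ; fromℕ; inject₁; inject≤; splitAt)
import Data.Fin.Properties as Fin
open import Data.Fin.Relation.Unary.Top using (view; ‵fromℕ; ‵inject₁; view-fromℕ; view-inject₁)
open import Data.Integer.Base as ℤ using (ℤ; +_; -[1+_]; 0ℤ; 1ℤ; -1ℤ)
import Data.Integer.Properties as ℤ
open import Data.List.Base using (List; []; _∷_; length)
import Data.List.Membership.Setoid as Membership
open import Data.List.Relation.Unary.Any as Any using (here; there)
open import Data.Nat.Base using (ℕ; zero; suc; pred; _+_; _*_; _≤_; _<_; z≤n; s≤s)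
open import Data.Nat.DivMod using (_mod_)
open import Data.Nat.GeneralisedArithmetic using (iterate)
open import Data.Nat.Properties using (m≤n⇒∃[o]m+o≡n; +-comm; n<1+n)
open import Data.Nat.Solver using (module +-*-Solver)
open import Data.Product.Base using (_×_; _,_; proj₁; proj₂; ∃-syntax; map₁)
open import Data.Product.Function.NonDependent.Propositional using (_×-↔_)
import Data.Product.Properties as Product
open import Data.Sum.Base using (_⊎_; inj₁; inj₂; [_,_]′)
open import Data.Sum.Function.Propositional using (_⊎-↔_)
import Data.Sum.Properties as Sum
open import Data.Unit.Base using (⊤; tt)
open import Data.Vec.Base using (Vec; []; _∷_; lookup)
open import Function.Base using (_∘_; case_of_)
open import Function.Bundles using (Inverse; Injection; _↔_; mk↔ₛ′)
open import Function.Construct.Composition using (_↔-∘_; inverse)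
open import Function.Construct.Identity using (↔-id)
open import Function.Construct.Symmetry using (↔-sym)
open import Function.Properties.Inverse using (↔⇒↣)
open import Level using (0ℓ)
open import Relation.Binary.Bundles using (Setoid)
open import Relation.Binary.Construct.Closure.Equivalence as EqC using (EqClosure)
open import Relation.Binary.Construct.Closure.ReflexiveTransitive using (ε; _◅_; _◅◅_)
open import Relation.Binary.Construct.Closure.Symmetric using (fwd; bwd)
open import Relation.Binary.Core using (Rel)
open import Relation.Binary.Definitions using (Decidable; DecidableEquality)
open import Relation.Binary.PropositionalEquality
  using (_≡_; _≢_; refl; sym; trans; cong; cong₂; subst; setoid; isEquivalence; module ≡-Reasoning)
open import Relation.Binary.Structures using (IsEquivalence)
open import Relation.Nullary.Decidable
  using (Dec; yes; no; does; True; toWitness; from-yes; map′; via-injection; ¬?; _×-dec_; _⊎-dec_; _→-dec_)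
open import Relation.Nullary.Negation using (¬_; contradiction)

-- Exchanging branched vertices with branched faces makes the number of branched cells even. Two
-- would give a sphere again; four give genus `m - 1` for `m` sheets, hence every genus. The cover
-- is the derived map of a voltage assignment `s`: the rotation at a dart `d` moves the sheets by
-- the power `s d` of one cyclic permutation. Voltages are kept in ℤ, so that one finite computation
-- on the base serves every `g`. A sum of ±1 around a cell forces total ramification for every
-- number of sheets, and a sum of 0 forbids ramification. The sum of all voltages is the total over
-- the vertices and also the total over the faces; the duality negates voltages, so this sum is 0
-- and the two branched vertices carry opposite signs, as do the two branched faces. Connectedness
-- after deleting vertices is not a local property and does not lift from the base. It is therefore
-- derived on the cover itself, from incidence conditions that do lift.

private variable
  A B I D : Set

-- Orbits of a permutation of a finite set

↔-injective : (f : A ↔ B) → ∀ {x y} → Inverse.to f x ≡ Inverse.to f y → x ≡ y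
↔-injective f = Injection.injective (↔⇒↣ f)

iterate-+ : ∀ (f : A → A) x m n → iterate f x (m + n) ≡ iterate f (iterate f x m) n
iterate-+ f x zero    n = refl
iterate-+ f x (suc m) n = iterate-+ f (f x) m n

module _ {k} (finite : A ↔ Fin k) (f : A ↔ A) where
  open Inverse f using (to; from; strictlyInverseʳ)
  open ≡-Reasoning

  iterate-injective : ∀ n {x y} → iterate to x n ≡ iterate to y n → x ≡ y
  iterate-injective zero    eq = eq
  iterate-injective (suc n) eq = ↔-injective f (iterate-injective n eq)

  iterate-returns : ∀ x → ∃[ n ] iterate to (to x) n ≡ x
  iterate-returns x
    with i , j , i<j , eq ← Fin.pigeonhole (n<1+n k)
           (λ (i : Fin (suc k)) → Inverse.to finite (iterate to x (toℕ i)))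
    with n , 1+i+n≡j ← m≤n⇒∃[o]m+o≡n i<j
    = n , iterate-injective (toℕ i) (begin
      iterate to (iterate to x (suc n)) (toℕ i)  ≡⟨ iterate-+ to x (suc n) (toℕ i) ⟨
      iterate to x (suc n + toℕ i)               ≡⟨ cong (iterate to x ∘ suc) (+-comm n (toℕ i)) ⟩
      iterate to x (suc (toℕ i) + n)             ≡⟨ cong (iterate to x) 1+i+n≡j ⟩
      iterate to x (toℕ j)                       ≡⟨ ↔-injective finite eq ⟨
      iterate to x (toℕ i)                       ∎)

  -- On a finite set a backward link can be replaced by going forward around the rest of the cycle.
  orbit-iterate : ∀ {x y} → EqClosure (λ u v → to u ≡ v) x y → ∃[ n ] iterate to x n ≡ y
  orbit-iterate ε = 0 , refl
  orbit-iterate (fwd refl ◅ p) = let n , eq = orbit-iterate p in suc n , eq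
  orbit-iterate (_◅_ {j = y} (bwd refl) p) =
    let m , back = iterate-returns y
        n , eq   = orbit-iterate p
    in m + n , trans (iterate-+ to (to y) m n) (trans (cong (λ z → iterate to z n) back) eq)

  -- Nothing is required of the step from from z to z: a cycle with one link
  -- removed is still connected.
  walk : (P : A → Set) {R : Rel A 0ℓ} → DecidableEquality A → IsEquivalence R → ∀ {z} →
         (∀ {y} → P y → to y ≢ z → R y (to y) × P (to y)) →
         ∀ {y} → P y → EqClosure (λ u v → to u ≡ v) (to y) z → R y (from z)
  walk P {R} _≟_ equiv {z} step py orbit = let n , eq = orbit-iterate orbit in go n py eq
    where
    open IsEquivalence equiv using () renaming (refl to R-refl; trans to R-trans)

    arrived : ∀ {y} → to y ≡ z → R y (from z)
    arrived {y} refl = subst (R y) (sym (strictlyInverseʳ y)) R-refl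

    go : ∀ n {y} → P y → iterate to (to y) n ≡ z → R y (from z)
    go zero    _  eq = arrived eq
    -- The orbit may meet `z` before the given number of steps, and `step` cannot enter `z`; so the
    -- walk stops at the first arrival.
    go (suc n) {y} py eq with to y ≟ z
    ... | yes y→z = arrived y→z
    ... | no  y↛z = let r , py′ = step py y↛z in R-trans r (go n py′ eq)

-- Polyhedrality from local conditions

module _ (M : Map) where
  open Map M

  private
    module V = Setoid Vertices
    module F = Setoid Faces

  next : Dart → Dart
  next = Inverse.to φ

  prev : Dart → Dart
  prev = Inverse.from φ

  _≟_ : DecidableEquality Dart
  _≟_ = via-injection (↔⇒↣ finite) Fin._≟_

  anyDart? : {P : Dart → Set} → (∀ x → Dec (P x)) → Dec (∃[ x ] P x)
  anyDart? {P} P? = map′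
    (λ (i , p) → Inverse.from finite i , p)
    (λ (x , p) → Inverse.to finite x , subst P (sym (Inverse.strictlyInverseʳ finite x)) p)
    (Fin.any? (P? ∘ Inverse.from finite))

  rot-same : ∀ x → SameVertex x (rot x)
  rot-same x = EqC.return refl

  next-same : ∀ x → SameFace x (next x)
  next-same x = EqC.return refl

  α-next : ∀ x → SameVertex (α x) (next x)
  α-next x = rot-same (α x)

  next-prev : ∀ x → next (prev x) ≡ x
  next-prev = Inverse.strictlyInverseˡ φ

  -- The corners p, p′ at one vertex and q, q′ at another witness that both
  -- vertices lie on the faces of p and p′.  In the last two cases they are the
  -- ends of an edge p, respectively q, having these faces on its two sides.
  ProperIntersections : Set
  ProperIntersections = ∀ {p p′ q q′} → SameVertex p p′ → SameVertex q q′ →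
    SameFace p q → SameFace p′ q′ →
    SameFace p p′ ⊎ SameVertex p q ⊎ q′ ≡ α p ⊎ p′ ≡ α q

  proper⇒connectedIntersection : ProperIntersections →
    ∀ c d → ¬ SameFace c d → ConnectedIntersection M c d
  proper⇒connectedIntersection proper c d c≁d x y
    (p , x~p , p~c) (p′ , x~p′ , p′~d) (q , y~q , q~c) (q′ , y~q′ , q′~d)
    with proper (V.trans (V.sym x~p) x~p′) (V.trans (V.sym y~q) y~q′)
                (F.trans p~c (F.sym q~c)) (F.trans p′~d (F.sym q′~d))
  ... | inj₁ p~p′ = contradiction (F.trans (F.sym p~c) (F.trans p~p′ p′~d)) c≁d
  ... | inj₂ (inj₁ p~q) = EqC.return (inj₁ (V.trans x~p (V.trans p~q (V.sym y~q))))
  ... | inj₂ (inj₂ (inj₁ refl)) =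
        EqC.return (inj₁ x~p) ◅◅ EqC.return (inj₂ (refl , inj₁ p~c , inj₂ q′~d)) ◅◅
        EqC.return (inj₁ (V.sym y~q′))
  ... | inj₂ (inj₂ (inj₂ refl)) =
        EqC.return (inj₁ x~p′) ◅◅
        EqC.symmetric _ (EqC.return (inj₂ (refl , inj₁ q~c , inj₂ p′~d))) ◅◅
        EqC.return (inj₁ (V.sym y~q))

  -- Each condition involves only a few corners, so it can be checked on the base and lifted. The
  -- orbits are given as closures, whence the two decision procedures.
  record IsLocallyPolyhedral : Set where
    field
      simple      : IsSimple M
      simpleFaces : HasSimpleFaces M
      proper      : ProperIntersections
      no-leaf     : ∀ x → rot x ≢ x
      no-digon    : ∀ x → next (next x) ≢ x
      _~ᵛ?_       : Decidable SameVertex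
      _~ᶠ?_       : Decidable SameFace

  -- Around a removed vertex the boundaries of its faces form a cycle through
  -- all its neighbours.  The cycle passes through another removed vertex at
  -- most once, so it remains connected, and paths can be rerouted along it.
  module Separation (local : IsLocallyPolyhedral) (X : List Dart) (|X|<3 : length X < 3) where
    open IsLocallyPolyhedral local
    open Membership Vertices using (_∈_; _∉_)

    loopless : ∀ {x} → ¬ SameVertex x (α x)
    loopless = proj₁ simple _

    ∈-resp : ∀ {x y} → SameVertex x y → x ∈ X → y ∈ X
    ∈-resp x~y = Any.map (V.trans (V.sym x~y))

    ∉-resp : ∀ {x y} → SameVertex x y → x ∉ X → y ∉ X
    ∉-resp x~y x∉X y∈X = x∉X (∈-resp (V.sym x~y) y∈X)

    _∈X? : ∀ x → Dec (x ∈ X)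
    x ∈X? = Any.any? (x ~ᵛ?_) X

    two-removed : ∀ {x y z} → x ∈ X → y ∈ X → z ∈ X →
                  SameVertex x y ⊎ SameVertex x z ⊎ SameVertex y z
    two-removed = go X |X|<3
      where
      join : ∀ {x y z} → SameVertex x z → SameVertex y z → SameVertex x y
      join p q = V.trans p (V.sym q)

      go : ∀ X → length X < 3 → ∀ {x y z} → x ∈ X → y ∈ X → z ∈ X →
           SameVertex x y ⊎ SameVertex x z ⊎ SameVertex y z
      go _ _ (here p) (here q) _ = inj₁ (join p q)
      go _ _ (here p) _ (here r) = inj₂ (inj₁ (join p r))
      go _ _ _ (here q) (here r) = inj₂ (inj₂ (join q r))
      go _ _ (there (here p)) (there (here q)) _ = inj₁ (join p q)
      go _ _ (there (here p)) _ (there (here r)) = inj₂ (inj₁ (join p r))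
      go _ _ _ (there (here q)) (there (here r)) = inj₂ (inj₂ (join q r))
      go (_ ∷ _ ∷ _ ∷ _) (s≤s (s≤s (s≤s ())))

    Joined : Rel Dart 0ℓ
    Joined = ConnectedAvoiding M X

    joined-isEquivalence : IsEquivalence Joined
    joined-isEquivalence = EqC.isEquivalence _

    open IsEquivalence joined-isEquivalence
      using () renaming (refl to J-refl; sym to J-sym; trans to J-trans)

    join-vertex : ∀ {x y} → x ∉ X → SameVertex x y → Joined x y
    join-vertex x∉X x~y = EqC.return (x∉X , ∉-resp x~y x∉X , inj₁ x~y)

    join-next : ∀ {x} → x ∉ X → next x ∉ X → Joined x (next x)
    join-next {x} x∉X nx∉X =
      J-trans (EqC.return (x∉X , αx∉X , inj₂ refl)) (join-vertex αx∉X (α-next x))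
      where
      αx∉X : α x ∉ X
      αx∉X = ∉-resp (V.sym (α-next x)) nx∉X

    next-≢ : ∀ {x} → next x ≢ x
    next-≢ {x} eq = loopless (V.sym (subst (SameVertex (α x)) eq (α-next x)))

    Clear : Dart → Set
    Clear x = ∀ s → SameFace x s → s ≢ x → s ∉ X

    -- The face of `rot x` lies between the consecutive edges of `x` and `rot x`. Its boundary
    -- without their common tail is a path between their other ends.
    clear⇒joined : ∀ {x} → Clear (rot x) → Joined (α x) (α (rot x))
    clear⇒joined {x} clear = J-sym (J-trans
      (join-vertex (∉-resp (V.sym (α-next y)) (clear _ (next-same y) next-≢)) (α-next y))
      (subst (λ z → Joined (next y) (α z)) (Inverse.strictlyInverseʳ σ x)
        (walk finite φ (λ w → SameFace y w × w ≢ y) _≟_ joined-isEquivalence {z = y}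
          (λ { {w} (y~w , w≢y) nw≢y →
               join-next (clear w y~w w≢y)
                         (clear (next w) (F.trans y~w (next-same w)) nw≢y) ,
               (F.trans y~w (next-same w) , nw≢y) })
          (next-same y , next-≢)
          (F.sym (F.trans (next-same y) (next-same (next y)))))))
      where
      y = rot x

    on-α : IsEquivalence (λ u v → Joined (α u) (α v))
    on-α = record { refl = J-refl ; sym = J-sym ; trans = J-trans }

    -- Going around x, the only obstacle is a removed neighbour or, if there is
    -- none, a single face containing another removed vertex; t is the last
    -- neighbour before it.
    rim-joined : ∀ {x} → x ∈ X →
      ∃[ t ] ∀ y → SameVertex x y → α y ∉ X → Joined (α y) t
    rim-joined {x} x∈X
      with anyDart? (λ b → (x ~ᵛ? b) ×-dec (α b ∈X?))
    ... | yes (b , x~b , αb∈X) = α (Inverse.from σ b) , λ y x~y αy∉X →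
          walk finite σ (λ w → SameVertex x w × w ≢ b) _≟_ on-α {z = b}
            (λ { {w} (x~w , w≢b) rw≢b → clear⇒joined (clear x~w w≢b rw≢b) ,
                                          (V.trans x~w (rot-same w) , rw≢b) })
            (x~y , λ { refl → αy∉X αb∈X })
            (V.trans (V.sym (rot-same y)) (V.trans (V.sym x~y) x~b))
      where
      clear : ∀ {w} → SameVertex x w → w ≢ b → rot w ≢ b → Clear (rot w)
      clear {w} x~w w≢b rw≢b s rw~s s≢rw s∈X with two-removed x∈X αb∈X s∈X
      ... | inj₁ x~αb = loopless (V.trans (V.sym x~b) x~αb)
      ... | inj₂ (inj₁ x~s) =
            s≢rw (sym (simpleFaces _ _ rw~s (V.trans (V.sym (V.trans x~w (rot-same w))) x~s)))
      -- The faces of `rot w` and `b` share `x` and the removed neighbour, so they would meet along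
      -- the edge of `b`. Only two faces at `x` contain this edge, and `w≢b` and `rw≢b` exclude
      -- them.
      ... | inj₂ (inj₂ αb~s) = case proper rw~b s~nb rw~s (next-same b) of λ where
            (inj₁ rw~ᶠb) → rw≢b (simpleFaces _ _ rw~ᶠb rw~b)
            (inj₂ (inj₁ rw~ᵛs)) → s≢rw (sym (simpleFaces _ _ rw~s rw~ᵛs))
            (inj₂ (inj₂ (inj₁ nb≡αrw))) → rw≢b (proj₂ simple _ _ rw~b
              (V.sym (subst (SameVertex (α b)) nb≡αrw (α-next b))))
            (inj₂ (inj₂ (inj₂ b≡αs))) → w≢b (↔-injective σ
              (simpleFaces _ _
                (F.trans rw~s (subst (λ z → SameFace s (rot z)) (sym b≡αs) (next-same s)))
                (V.trans rw~b (rot-same b))))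
        where
        rw~b : SameVertex (rot w) b
        rw~b = V.trans (V.sym (V.trans x~w (rot-same w))) x~b

        s~nb : SameVertex s (next b)
        s~nb = V.trans (V.sym αb~s) (α-next b)
    ... | no ¬spoke
      with anyDart? (λ z → (x ~ᵛ? z) ×-dec
             anyDart? (λ s → (z ~ᶠ? s) ×-dec (¬? (s ≟ z) ×-dec (s ∈X?))))
    ...   | yes (z , x~z , s , z~s , s≢z , s∈X) = α (Inverse.from σ z) , λ y x~y αy∉X →
            walk finite σ (SameVertex x) _≟_ on-α {z = z}
              (λ {w} x~w rw≢z → clear⇒joined (clear (V.trans x~w (rot-same w)) rw≢z) ,
                                 V.trans x~w (rot-same w))
              x~y
              (V.trans (V.sym (rot-same y)) (V.trans (V.sym x~y) x~z))
      where
      off-face : ∀ {w t} → SameVertex x w → SameFace w t → t ≢ w → ¬ SameVertex x t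
      off-face x~w w~t t≢w x~t = t≢w (sym (simpleFaces _ _ w~t (V.trans (V.sym x~w) x~t)))

      clear : ∀ {w} → SameVertex x w → w ≢ z → Clear w
      clear {w} x~w w≢z t w~t t≢w t∈X with two-removed x∈X s∈X t∈X
      ... | inj₁ x~s = off-face x~z z~s s≢z x~s
      ... | inj₂ (inj₁ x~t) = off-face x~w w~t t≢w x~t
      -- Distinct faces at `x` that share another vertex meet in an edge to it, but no neighbour of
      -- `x` is removed here.
      ... | inj₂ (inj₂ s~t) = case proper (V.trans (V.sym x~z) x~w) s~t z~s w~t of λ where
            (inj₁ z~w) → w≢z (sym (simpleFaces _ _ z~w (V.trans (V.sym x~z) x~w)))
            (inj₂ (inj₁ z~ᵛs)) → off-face x~z z~s s≢z (V.trans x~z z~ᵛs)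
            (inj₂ (inj₂ (inj₁ refl))) → ¬spoke (z , x~z , t∈X)
            (inj₂ (inj₂ (inj₂ refl))) →
              ¬spoke (w , x~w , subst (_∈ X) (sym (α-involutive s)) s∈X)
    ...   | no ¬blocked = α (Inverse.from σ x) , λ y x~y αy∉X →
            walk finite σ (SameVertex x) _≟_ on-α {z = x}
              (λ {w} x~w rw≢z → clear⇒joined (clear (V.trans x~w (rot-same w))) ,
                                 V.trans x~w (rot-same w))
              x~y
              (V.trans (V.sym (rot-same y)) (V.sym x~y))
      where
      clear : ∀ {w} → SameVertex x w → Clear w
      clear x~w t w~t t≢w t∈X = ¬blocked (_ , x~w , t , w~t , t≢w , t∈X)

    -- A surviving vertex is its own substitute; a removed one is replaced by
    -- any of its surviving neighbours.
    Substitute : Dart → Dart → Set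
    Substitute x y =
      y ∉ X × ((x ∉ X × SameVertex x y) ⊎ (x ∈ X × SameVertex x (α y)))

    substitute-resp : ∀ {x y p} → SameVertex x y → Substitute x p → Substitute y p
    substitute-resp x~y (p∉X , inj₁ (x∉X , x~p)) =
      p∉X , inj₁ (∉-resp x~y x∉X , V.trans (V.sym x~y) x~p)
    substitute-resp x~y (p∉X , inj₂ (x∈X , x~αp)) =
      p∉X , inj₂ (∈-resp x~y x∈X , V.trans (V.sym x~y) x~αp)

    neighbour : ∀ {x y} → x ∈ X → SameVertex x y → α y ∉ X → Substitute x (α y)
    neighbour {x} {y} x∈X x~y αy∉X =
      αy∉X , inj₂ (x∈X , subst (SameVertex x) (sym (α-involutive y)) x~y)

    substitute-exists : ∀ x → ∃[ y ] Substitute x y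
    substitute-exists x with x ∈X?
    ... | no x∉X = x , x∉X , inj₁ (x∉X , V.refl)
    ... | yes x∈X with α x ∈X? | α (rot x) ∈X?
    ...   | no αx∉X | _ = α x , neighbour x∈X V.refl αx∉X
    ...   | _ | no αrx∉X = α (rot x) , neighbour x∈X (rot-same x) αrx∉X
    ...   | yes αx∈X | yes αrx∈X with two-removed x∈X αx∈X αrx∈X
    ...     | inj₁ x~αx = contradiction x~αx loopless
    ...     | inj₂ (inj₁ x~αrx) = contradiction (V.trans (V.sym (rot-same x)) x~αrx) loopless
    ...     | inj₂ (inj₂ αx~αrx) =
              contradiction (sym (proj₂ simple _ _ (rot-same x) αx~αrx)) (no-leaf x)

    substitutes-joined : ∀ {x p q} → Substitute x p → Substitute x q → Joined p q
    substitutes-joined (p∉X , inj₁ (_ , x~p)) (_ , inj₁ (_ , x~q)) =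
      join-vertex p∉X (V.trans (V.sym x~p) x~q)
    substitutes-joined (_ , inj₁ (x∉X , _)) (_ , inj₂ (x∈X , _)) = contradiction x∈X x∉X
    substitutes-joined (_ , inj₂ (x∈X , _)) (_ , inj₁ (x∉X , _)) = contradiction x∈X x∉X
    substitutes-joined {x} (p∉X , inj₂ (x∈X , x~αp)) (q∉X , inj₂ (_ , x~αq)) =
      J-trans (to-rim p∉X x~αp) (J-sym (to-rim q∉X x~αq))
      where
      rim = rim-joined x∈X

      to-rim : ∀ {p} → p ∉ X → SameVertex x (α p) → Joined p (proj₁ rim)
      to-rim {p} p∉X x~αp = subst (λ z → Joined z (proj₁ rim)) (α-involutive p)
        (proj₂ rim (α p) x~αp (subst (_∉ X) (sym (α-involutive p)) p∉X))

    -- With both ends of the edge removed, every other vertex survives. The rest of the boundary of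
    -- the face of `x` is then a path from a neighbour of one end to a neighbour of the other;
    -- `no-digon` keeps it from being empty.
    bypass-edge : ∀ {x} → x ∈ X → α x ∈ X →
      ∃[ p ] ∃[ q ] Substitute x p × Substitute (α x) q × Joined p q
    bypass-edge {x} x∈X αx∈X =
        prev x , α (next x)
      , neighbour x∈X x~y (surviving x~ᶠprev prev≢x prev≢nx)
      , substitute-resp (V.sym (α-next x))
          (neighbour (∈-resp (α-next x) αx∈X) V.refl (∉-resp nn~αn nn∉X))
      , J-sym (J-trans
          (J-sym (join-vertex nn∉X nn~αn))
          (walk finite φ (λ w → SameFace x w × w ≢ x × w ≢ next x)
            _≟_ joined-isEquivalence {z = x}
            (λ { {w} (x~w , w≢x , w≢nx) nw≢x →
                 let x~nw   = F.trans x~w (next-same w)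
                     nw≢nx = λ eq → w≢x (↔-injective φ eq)
                 in join-next (surviving x~w w≢x w≢nx) (surviving x~nw nw≢x nw≢nx) ,
                    (x~nw , nw≢x , nw≢nx) })
            (x~ᶠnn , no-digon x , next-≢)
            (F.sym (F.trans x~ᶠnn (next-same _)))))
      where
      y = Inverse.from σ x

      x~y : SameVertex x y
      x~y = V.sym (subst (SameVertex y) (Inverse.strictlyInverseˡ σ x) (rot-same y))

      x~ᶠprev : SameFace x (prev x)
      x~ᶠprev = F.sym (subst (SameFace (prev x)) (next-prev x) (next-same (prev x)))

      x~ᶠnn : SameFace x (next (next x))
      x~ᶠnn = F.trans (next-same x) (next-same (next x))

      prev≢x : prev x ≢ x
      prev≢x eq = next-≢ (trans (cong next (sym eq)) (next-prev x))

      prev≢nx : prev x ≢ next x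
      prev≢nx eq = no-digon x (trans (cong next (sym eq)) (next-prev x))

      surviving : ∀ {w} → SameFace x w → w ≢ x → w ≢ next x → w ∉ X
      surviving x~w w≢x w≢nx w∈X with two-removed x∈X αx∈X w∈X
      ... | inj₁ x~αx = loopless x~αx
      ... | inj₂ (inj₁ x~ᵛw) = w≢x (sym (simpleFaces _ _ x~w x~ᵛw))
      ... | inj₂ (inj₂ αx~w) = w≢nx (sym (simpleFaces _ _
              (F.trans (F.sym (next-same x)) x~w) (V.trans (V.sym (α-next x)) αx~w)))

      nn∉X : next (next x) ∉ X
      nn∉X = surviving x~ᶠnn (no-digon x) next-≢

      nn~αn : SameVertex (next (next x)) (α (next x))
      nn~αn = V.sym (α-next (next x))

    SubstitutesJoined : Rel Dart 0ℓ
    SubstitutesJoined x y = ∀ {p q} → Substitute x p → Substitute y q → Joined p q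

    substitutesJoined-isEquivalence : IsEquivalence SubstitutesJoined
    substitutesJoined-isEquivalence = record
      { refl  = substitutes-joined
      ; sym   = λ xy q p → J-sym (xy p q)
      -- The middle vertex may be removed, so a substitute for it must exist.
      ; trans = λ {_} {y} xy yz p r →
          let _ , q = substitute-exists y in J-trans (xy p q) (yz q r)
      }

    linked : ∀ {x y} → rot x ≡ y ⊎ α x ≡ y → SubstitutesJoined x y
    linked {x} (inj₁ refl) p q =
      substitutes-joined p (substitute-resp (V.sym (rot-same x)) q)
    linked {x} (inj₂ refl) p q with x ∈X? | α x ∈X?
    ... | no x∉X | no αx∉X =
          J-trans (substitutes-joined p (x∉X , inj₁ (x∉X , V.refl)))
            (J-trans (EqC.return (x∉X , αx∉X , inj₂ refl))
              (substitutes-joined (αx∉X , inj₁ (αx∉X , V.refl)) q))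
    ... | no x∉X | yes αx∈X =
          J-trans (substitutes-joined p (x∉X , inj₁ (x∉X , V.refl)))
            (substitutes-joined (x∉X , inj₂ (αx∈X , V.refl)) q)
    ... | yes x∈X | no αx∉X =
          J-trans (substitutes-joined p (neighbour x∈X V.refl αx∉X))
            (substitutes-joined (αx∉X , inj₁ (αx∉X , V.refl)) q)
    ... | yes x∈X | yes αx∈X =
          let _ , _ , p′ , q′ , p′~q′ = bypass-edge x∈X αx∈X
          in J-trans (substitutes-joined p p′) (J-trans p′~q′ (substitutes-joined q′ q))

    survivors-joined : ∀ x y → x ∉ X → y ∉ X → Joined x y
    survivors-joined x y x∉X y∉X =
      EqC.fold substitutesJoined-isEquivalence linked (connected x y)
        (x∉X , inj₁ (x∉X , V.refl)) (y∉X , inj₁ (y∉X , V.refl))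

  locallyPolyhedral⇒polyhedral : IsLocallyPolyhedral →
    Injection (setoid (Fin 4)) Vertices → IsPolyhedral M
  locallyPolyhedral⇒polyhedral local four = record
    { simple       = simple
    ; 3-connected  = four , λ X |X|<3 → Separation.survivors-joined local X |X|<3
    ; simpleFaces  = simpleFaces
    ; intersection = proper⇒connectedIntersection proper
    }
    where open IsLocallyPolyhedral local

-- Sheets and their integer shifts

cycle : ∀ n → Fin (suc n) ↔ Fin (suc n)
cycle n = mk↔ₛ′ down up down-up up-down
  where
  down : ∀ {n} → Fin (suc n) → Fin (suc n)
  down zero    = fromℕ _
  down (suc i) = inject₁ i

  up : ∀ {n} → Fin (suc n) → Fin (suc n)
  up i with view i
  ... | ‵fromℕ     = zero
  ... | ‵inject₁ j = suc j

  down-up : ∀ {n} (i : Fin (suc n)) → down (up i) ≡ i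
  down-up i with view i
  ... | ‵fromℕ     = refl
  ... | ‵inject₁ j = refl

  up-down : ∀ {n} (i : Fin (suc n)) → up (down i) ≡ i
  up-down {n} zero rewrite view-fromℕ n = refl
  up-down (suc i) rewrite view-inject₁ i = refl

Transitive : A ↔ A → Set
Transitive f = ∀ x y → EqClosure (λ u v → Inverse.to f u ≡ v) x y

cycle-transitive : ∀ n → Transitive (cycle n)
cycle-transitive n i j = to-zero i ◅◅ EqC.symmetric _ (to-zero j)
  where
  R = λ u v → Inverse.to (cycle n) u ≡ v

  go : ∀ k (i : Fin (suc n)) → toℕ i ≡ k → EqClosure R i zero
  go _ zero    _  = ε
  go (suc k) (suc i) eq =
    EqC.return refl ◅◅ go k (inject₁ i) (trans (Fin.toℕ-inject₁ i) (cong pred eq))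

  to-zero : ∀ i → EqClosure R i zero
  to-zero i = go (toℕ i) i refl

module Powers (c : I ↔ I) where
  open Inverse c using (to; from; strictlyInverseˡ; strictlyInverseʳ)

  infixr 6 _·_
  _·_ : ℤ → I → I
  (+ zero)     · i = i
  (+ suc n)    · i = to ((+ n) · i)
  -[1+ zero  ] · i = from i
  -[1+ suc n ] · i = from (-[1+ n ] · i)

  suc-· : ∀ k i → ℤ.suc k · i ≡ to (k · i)
  suc-· (+ n)        i = refl
  suc-· -[1+ zero  ] i = sym (strictlyInverseˡ i)
  suc-· -[1+ suc n ] i = sym (strictlyInverseˡ _)

  pred-· : ∀ k i → ℤ.pred k · i ≡ from (k · i)
  pred-· (+ zero)  i = refl
  pred-· (+ suc n) i = sym (strictlyInverseʳ _)
  pred-· -[1+ n ]  i = refl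

  +-· : ∀ j k i → (j ℤ.+ k) · i ≡ j · k · i
  +-· (+ zero)  k i = cong (_· i) (ℤ.+-identityˡ k)
  +-· (+ suc n) k i =
    trans (cong (_· i) (ℤ.suc-+ n k))
      (trans (suc-· ((+ n) ℤ.+ k) i) (cong to (+-· (+ n) k i)))
  +-· -[1+ zero ]  k i = pred-· k i
  +-· -[1+ suc n ] k i =
    trans (cong (_· i) (ℤ.pred-+ -[1+ n ] k))
      (trans (pred-· (-[1+ n ] ℤ.+ k) i) (cong from (+-· -[1+ n ] k i)))

  ·-inverse : ∀ {j k} → j ℤ.+ k ≡ 0ℤ → ∀ i → j · k · i ≡ i
  ·-inverse {j} {k} eq i = trans (sym (+-· j k i)) (cong (_· i) eq)

  ·-injective : ∀ k {i j} → k · i ≡ k · j → i ≡ j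
  ·-injective k {i} {j} eq =
    trans (sym (inv i)) (trans (cong ((ℤ.- k) ·_) eq) (inv j))
    where inv = ·-inverse {ℤ.- k} {k} (ℤ.+-inverseˡ k)

  -- The derived permutation of the voltage assignment `s`.
  shiftBy : (D ↔ D) → (D → ℤ) → (I × D) ↔ (I × D)
  shiftBy p s = mk↔ₛ′
    (λ (i , d) → s d · i , P.to d)
    (λ (i , d) → (ℤ.- s (P.from d)) · i , P.from d)
    (λ (i , d) → cong₂ _,_
      (·-inverse {s (P.from d)} (ℤ.+-inverseʳ (s (P.from d))) i) (P.strictlyInverseˡ d))
    (λ (i , d) → cong₂ _,_
      (trans (cong (λ e → (ℤ.- s e) · s d · i) (P.strictlyInverseʳ d))
        (·-inverse {ℤ.- s d} (ℤ.+-inverseˡ (s d)) i))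
      (P.strictlyInverseʳ d))
    where module P = Inverse p

-- The lift with ℤ as set of sheets. Acting on a sheet `i` carries its iterates to those in any
-- cover, so sums of shifts can be computed here.
shift : (D → D) → (D → ℤ) → ℤ × D → ℤ × D
shift p s (k , d) = s d ℤ.+ k , p d

-- Ramified orbits and their lifts

Ramified : {b u : ℕ} → Fin b ⊎ Fin u → Set
Ramified (inj₁ _) = ⊤
Ramified (inj₂ _) = ⊥

ramified? : ∀ {b u} (w : Fin b ⊎ Fin u) → Dec (Ramified w)
ramified? (inj₁ _) = yes tt
ramified? (inj₂ _) = no λ ()

-- The shifts s along an orbit of p add up to ±1 for each of the b ramified
-- orbits and to 0 for the u others, on which height is a potential for s.
record Ramification (p : D → D) (s : D → ℤ) (b u : ℕ) : Set where
  field
    label         : D → Fin b ⊎ Fin u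
    root          : Fin b ⊎ Fin u → D
    height        : D → ℤ
    label-p       : ∀ d → label (p d) ≡ label d
    label-root    : ∀ w → label (root w) ≡ w
    reaches-root  : ∀ d → ∃[ n ] iterate p d n ≡ root (label d)
    height-p      : ∀ d → Ramified (label d) ⊎ height (p d) ℤ.+ s d ≡ height d
    height-root   : ∀ w → height (root (inj₂ w)) ≡ 0ℤ
    monodromy     : ∀ w → let r = root (inj₁ w) in ∃[ n ]
      (iterate (shift p s) (0ℤ , r) n ≡ (1ℤ , r) ⊎ iterate (shift p s) (0ℤ , r) n ≡ (-1ℤ , r))

  infix 4 _∼_
  _∼_ : D → D → Set
  d ∼ e = label d ≡ label e

  RamifiedAt : D → Set
  RamifiedAt d = Ramified (label d)

iterate-map : (h : A → B) {f : A → A} {g : B → B} → (∀ x → h (f x) ≡ g (h x)) →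
              ∀ n x → h (iterate f x n) ≡ iterate g (h x) n
iterate-map h eq zero    x = refl
iterate-map h {g = g} eq (suc n) x = trans (iterate-map h eq n _) (cong (λ y → iterate g y n) (eq x))

iterate-orbit : (f : A → A) → ∀ n x → EqClosure (λ u v → f u ≡ v) x (iterate f x n)
iterate-orbit f zero    x = ε
iterate-orbit f (suc n) x = EqC.return refl ◅◅ iterate-orbit f n (f x)

module LiftedOrbits
  (c : I ↔ I) (c-transitive : Transitive c)
  {p : D → D} {s : D → ℤ} {b u : ℕ} (ram : Ramification p s b u)
  (f : I × D → I × D) (f-shifts : ∀ i d → f (i , d) ≡ (Powers._·_ c (s d) i , p d))
  where
  open Powers c
  open Ramification ram

  private
    module Same = Setoid (Orbits f)

  infix 4 _≈_
  _≈_ : I × D → I × D → Set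
  _≈_ = Same._≈_

  -- A ramified orbit has a single lift, because shifts by ±1 reach all sheets; an unramified one
  -- has a lift for each sheet.
  Label : Set
  Label = Fin b ⊎ (I × Fin u)

  -- Over an unramified orbit, `height d · i` is the sheet in which the lifted orbit meets the fibre
  -- of the root.
  liftedLabel : I × D → Label
  liftedLabel (i , d) = [ inj₁ , (λ w → inj₂ (height d · i , w)) ]′ (label d)

  liftedLabel-f : ∀ x → liftedLabel (f x) ≡ liftedLabel x
  liftedLabel-f (i , d) rewrite f-shifts i d
    with label d | label (p d) | label-p d | height-p d
  ... | inj₁ _ | _ | refl | _ = refl
  ... | inj₂ w | _ | refl | inj₂ eq =
        cong (λ j → inj₂ (j , w)) (trans (sym (+-· (height (p d)) (s d) i)) (cong (_· i) eq))

  ≈⇒liftedLabel : ∀ {x y} → x ≈ y → liftedLabel x ≡ liftedLabel y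
  ≈⇒liftedLabel = EqC.gfold isEquivalence liftedLabel (λ { refl → sym (liftedLabel-f _) })

  ≈⇒∼ : ∀ {x y} → x ≈ y → proj₂ x ∼ proj₂ y
  ≈⇒∼ = EqC.gfold isEquivalence (label ∘ proj₂)
    (λ { {i , d} refl → sym (trans (cong (label ∘ proj₂) (f-shifts i d)) (label-p d)) })

  ≈-root : ∀ x → ∃[ j ] x ≈ (j , root (label (proj₂ x)))
  ≈-root x@(i , d) =
    let n , eq = reaches-root d
        orbit  = iterate-orbit f n x
        end    = iterate-map proj₂ (λ (i , d) → cong proj₂ (f-shifts i d)) n x
    in proj₁ (iterate f x n) , subst (λ e → x ≈ (proj₁ (iterate f x n) , e)) (trans end eq) orbit

  iterate-lift : ∀ n k i d →
    map₁ (_· i) (iterate (shift p s) (k , d) n) ≡ iterate f (k · i , d) n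
  iterate-lift n k i d = iterate-map (map₁ (_· i))
    (λ (k , d) → trans (cong (_, p d) (+-· (s d) k i)) (sym (f-shifts (k · i) d))) n (k , d)

  ramified-step : ∀ w i → (i , root (inj₁ w)) ≈ (Inverse.to c i , root (inj₁ w))
  ramified-step w i with monodromy w
  ... | n , inj₁ eq =
        subst (_ ≈_) (trans (sym (iterate-lift n 0ℤ i _)) (cong (map₁ (_· i)) eq))
          (iterate-orbit f n (i , root (inj₁ w)))
  ... | n , inj₂ eq = Same.sym
        (subst ((j , r) ≈_)
          (trans (sym (iterate-lift n 0ℤ j r)) (trans (cong (map₁ (_· j)) eq)
            (cong (_, r) (Inverse.strictlyInverseʳ c i))))
          (iterate-orbit f n (j , r)))
    where
    j = Inverse.to c i
    r = root (inj₁ w)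

  ramified-roots : ∀ w i j → (i , root (inj₁ w)) ≈ (j , root (inj₁ w))
  ramified-roots w i j =
    EqC.gfold Same.isEquivalence (_, root (inj₁ w)) (λ { refl → ramified-step w _ }) (c-transitive i j)

  ramified-≈ : ∀ {x y} → RamifiedAt (proj₂ x) → proj₂ x ∼ proj₂ y → x ≈ y
  ramified-≈ {x} {y} ram x∼y with i , x≈ ← ≈-root x | j , y≈ ← ≈-root y
    with label (proj₂ x) | label (proj₂ y)
  ramified-≈ _ refl | inj₁ w | _ = Same.trans x≈ (Same.trans (ramified-roots w _ _) (Same.sym y≈))

  -- The tool for lifting incidences: around an unramified cell the height makes the sheet a
  -- function of the dart, so an equality of darts in the base becomes one in the cover.
  unramified-≡ : ∀ {x y} → x ≈ y → proj₂ x ≡ proj₂ y → ¬ RamifiedAt (proj₂ x) → x ≡ y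
  unramified-≡ {i , d} {j , _} x≈y refl ¬ram with label d | ≈⇒liftedLabel x≈y
  ... | inj₁ _ | _  = contradiction tt ¬ram
  ... | inj₂ _ | eq = cong (_, d) (·-injective (height d) (cong proj₁ (Sum.inj₂-injective eq)))

  section : I → Label → I × D
  -- The single lift of a ramified orbit meets every sheet, so any `i₀` will do.
  section i₀ (inj₁ w)       = i₀ , root (inj₁ w)
  section i₀ (inj₂ (i , w)) = i , root (inj₂ w)

  liftedLabel-section : ∀ i₀ l → liftedLabel (section i₀ l) ≡ l
  liftedLabel-section i₀ (inj₁ w) rewrite label-root (inj₁ w) = refl
  liftedLabel-section i₀ (inj₂ (i , w)) rewrite label-root (inj₂ w) | height-root w = refl

  ≈-section : ∀ i₀ x → x ≈ section i₀ (liftedLabel x)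
  ≈-section i₀ x with i , x≈ ← ≈-root x with label (proj₂ x) in eq
  ... | inj₁ w = Same.trans x≈ (ramified-roots w _ _)
  ... | inj₂ w = subst (λ j → x ≈ (j , root (inj₂ w))) (cong proj₁ (Sum.inj₂-injective (begin
      inj₂ (i , w)                     ≡⟨ liftedLabel-section i₀ (inj₂ (i , w)) ⟨
      liftedLabel (i , root (inj₂ w))  ≡⟨ ≈⇒liftedLabel x≈ ⟨
      liftedLabel x                    ≡⟨ cong [ inj₁ , (λ w → inj₂ (j , w)) ]′ eq ⟩
      inj₂ (j , w)                     ∎))) x≈
    where
    open ≡-Reasoning
    j = height (proj₂ x) · proj₁ x

  labels : I → Inverse (Orbits f) (setoid Label)
  labels i₀ = record
    { to        = liftedLabel
    ; from      = section i₀
    ; to-cong   = ≈⇒liftedLabel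
    ; from-cong = λ { refl → Same.refl }
    ; inverse   = (λ { y≈ → trans (≈⇒liftedLabel y≈) (liftedLabel-section i₀ _) })
                , (λ { refl → Same.sym (≈-section i₀ _) })
    }

  _≈?_ : DecidableEquality I → Decidable _≈_
  _≈?_ _≟_ x y = map′
    (λ eq → Same.trans (≈-section (proj₁ x) x)
      (subst (λ l → section (proj₁ x) l ≈ y) (sym eq) (Same.sym (≈-section (proj₁ x) y))))
    ≈⇒liftedLabel
    (Sum.≡-dec Fin._≟_ (Product.≡-dec _≟_ Fin._≟_) (liftedLabel x) (liftedLabel y))

-- The last three fields say that ramified vertices and faces are not incident,
-- and that no two of them share a face or a vertex.
record RamifiedPolyhedron (B : Map) (s : Map.Dart B → ℤ) (b u k : ℕ) : Set where
  open Map B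
  field
    V : Ramification rot s b u
    F : Ramification (next B) (s ∘ α) b u
    E : Ramification α (λ _ → 0ℤ) 0 k

  open Ramification V public using () renaming (_∼_ to _∼ᵛ_; RamifiedAt to RamifiedVertex)
  open Ramification F public using () renaming (_∼_ to _∼ᶠ_; RamifiedAt to RamifiedFace)

  field
    loopless        : ∀ d → ¬ d ∼ᵛ α d
    no-parallels    : ∀ d e → d ∼ᵛ e → α d ∼ᵛ α e → d ≡ e
    simple-faces    : ∀ d e → d ∼ᶠ e → d ∼ᵛ e → d ≡ e
    proper          : ∀ p p′ → p ∼ᵛ p′ → ∀ q → p ∼ᶠ q → ∀ q′ → q ∼ᵛ q′ → p′ ∼ᶠ q′ →
                      p ≡ p′ ⊎ p ≡ q ⊎ q′ ≡ α p ⊎ p′ ≡ α q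
    no-leaf         : ∀ d → rot d ≢ d
    no-digon        : ∀ d → next B (next B d) ≢ d
    faces-apart     : ∀ d e → d ∼ᵛ e → RamifiedFace d → RamifiedFace e → d ≡ e
    vertices-apart  : ∀ d e → d ∼ᶠ e → RamifiedVertex d → RamifiedVertex e → d ≡ e
    not-both        : ∀ d → RamifiedVertex d → ¬ RamifiedFace d

-- The branched cover of a polyhedron

module Cover
  {B : Map} {s : Map.Dart B → ℤ} {b u k : ℕ} (P : RamifiedPolyhedron B s b u k) (w₀ : Fin b)
  {I : Set} {m : ℕ} (I-finite : I ↔ Fin m) (c : I ↔ I) (c-transitive : Transitive c) (i₀ : I)
  where
  open RamifiedPolyhedron P
  open Powers c

  private
    module B = Map B
    module RV = Ramification V
    module RF = Ramification F

  -- Only σ changes the sheet, since shifts along α could be removed by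
  -- relabelling the sheets over each dart.
  coverσ : (I × B.Dart) ↔ (I × B.Dart)
  coverσ = shiftBy B.σ s

  coverα : I × B.Dart → I × B.Dart
  coverα (i , d) = i , B.α d

  private
    Link : I × B.Dart → I × B.Dart → Set
    Link x y = Inverse.to coverσ x ≡ y ⊎ coverα x ≡ y

    module LV = LiftedOrbits c c-transitive V (Inverse.to coverσ) (λ _ _ → refl)
    module LF = LiftedOrbits c c-transitive F (Inverse.to coverσ ∘ coverα) (λ _ _ → refl)
    module LE = LiftedOrbits c c-transitive E coverα (λ _ _ → refl)

    lift-path : ∀ {d e} → EqClosure (λ x y → B.rot x ≡ y ⊎ B.α x ≡ y) d e →
                ∀ i → ∃[ j ] EqClosure Link (i , d) (j , e)
    lift-path ε i = i , ε
    lift-path (fwd (inj₁ refl) ◅ path) i =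
      let j , p = lift-path path (s _ · i) in j , EqC.return (inj₁ refl) ◅◅ p
    lift-path (fwd (inj₂ refl) ◅ path) i =
      let j , p = lift-path path i in j , EqC.return (inj₂ refl) ◅◅ p
    lift-path (_◅_ {j = d} (bwd (inj₁ refl)) path) i =
      let j , p = lift-path path ((ℤ.- s d) · i)
      in j , EqC.symmetric _ (EqC.return (inj₁ (cong (_, B.rot d)
               (·-inverse {s d} (ℤ.+-inverseʳ (s d)) i)))) ◅◅ p
    lift-path (bwd (inj₂ refl) ◅ path) i =
      let j , p = lift-path path i in j , EqC.symmetric _ (EqC.return (inj₂ refl)) ◅◅ p

    -- Paths lift to the fibre over a root of the ramified vertex `w₀`, and the rotation there
    -- connects all sheets.
    linked : ∀ x y → EqClosure Link x y
    linked x y =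
      let i , x~ = to-root x
          j , y~ = to-root y
      in x~ ◅◅ EqC.map inj₁ (LV.ramified-roots w₀ i j) ◅◅ EqC.symmetric _ y~
      where
      to-root : ∀ x → ∃[ i ] EqClosure Link x (i , RV.root (inj₁ w₀))
      to-root (i , d) = lift-path (B.connected d _) i

  cover : Map
  cover = record
    { Dart         = I × B.Dart
    ; size         = m * B.size
    ; finite       = ↔-sym Fin.*↔× ↔-∘ (I-finite ×-↔ B.finite)
    ; σ            = coverσ
    ; α            = coverα
    ; α-involutive = λ (i , d) → cong (i ,_) (B.α-involutive d)
    ; α-free       = λ (i , d) eq → B.α-free d (cong proj₂ eq)
    ; connected    = linked
    }

  open Map cover

  private
    module SV = Setoid Vertices
    module SF = Setoid Faces

  ∼ᵛ-α : ∀ d → B.α d ∼ᵛ next B d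
  ∼ᵛ-α d = sym (RV.label-p (B.α d))

  cover-isSimple : IsSimple cover
  cover-isSimple = (λ (_ , d) x~αx → loopless d (LV.≈⇒∼ x~αx)) , parallel
    where
    -- Parallel edges lie over one edge. Its ends share a face, so they are not both ramified, and
    -- the unramified end determines the sheet.
    parallel : ∀ x y → SameVertex x y → SameVertex (α x) (α y) → x ≡ y
    parallel x@(_ , d) y x~y αx~αy
      with d≡e ← no-parallels _ _ (LV.≈⇒∼ x~y) (LV.≈⇒∼ αx~αy)
      with ramified? (RV.label d)
    ... | no ¬ram = LV.unramified-≡ x~y d≡e ¬ram
    ... | yes ram = trans (sym (α-involutive x)) (trans (cong α αx≡αy) (α-involutive y))
      where
      αx≡αy : α x ≡ α y
      αx≡αy = LV.unramified-≡ αx~αy (cong B.α d≡e) λ ram′ →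
        loopless d (trans
          (cong RV.label (vertices-apart d (next B d) (sym (RF.label-p d)) ram
            (subst Ramified (∼ᵛ-α d) ram′)))
          (RV.label-p (B.α d)))

  cover-simpleFaces : HasSimpleFaces cover
  cover-simpleFaces x@(_ , d) y x~ᶠy x~ᵛy
    with d≡e ← simple-faces _ _ (LF.≈⇒∼ x~ᶠy) (LV.≈⇒∼ x~ᵛy)
    with ramified? (RV.label d)
  ... | no ¬ram = LV.unramified-≡ x~ᵛy d≡e ¬ram
  ... | yes ram = LF.unramified-≡ x~ᶠy d≡e (not-both d ram)

  private
    Meeting : (p p′ q q′ : Dart) → Set
    Meeting p p′ q q′ = SameFace p p′ ⊎ SameVertex p q ⊎ q′ ≡ α p ⊎ p′ ≡ α q

    module _ {p p′ q q′}
      (p~p′ : SameVertex p p′) (q~q′ : SameVertex q q′)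
      (p~q : SameFace p q) (p′~q′ : SameFace p′ q′) where

      private
        d d′ e e′ : B.Dart
        d  = proj₂ p
        d′ = proj₂ p′
        e  = proj₂ q
        e′ = proj₂ q′

        d∼d′ : d ∼ᵛ d′
        d∼d′ = LV.≈⇒∼ p~p′

        e∼e′ : e ∼ᵛ e′
        e∼e′ = LV.≈⇒∼ q~q′

        d∼e : d ∼ᶠ e
        d∼e = LF.≈⇒∼ p~q

        d′∼e′ : d′ ∼ᶠ e′
        d′∼e′ = LF.≈⇒∼ p′~q′

      -- The faces of `p` and `p′` lie over one face. They coincide if it is ramified or if one of
      -- the two shared vertices is not. Otherwise two ramified vertices lie on this face, so
      -- `d ≡ e`, and the unramified face gives `p ≡ q`.
      same-corner : d ≡ d′ → Meeting p p′ q q′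
      same-corner d≡d′
        with ramified? (RF.label d) | ramified? (RV.label d) | ramified? (RV.label e)
      ... | yes ramF | _ | _ = inj₁ (LF.ramified-≈ ramF (cong RF.label d≡d′))
      ... | no _ | no ¬ram | _ = inj₁ (SF.reflexive (LV.unramified-≡ p~p′ d≡d′ ¬ram))
      ... | no _ | yes _ | no ¬ram = inj₁ (SF.trans p~q (SF.trans
              (SF.reflexive (LV.unramified-≡ q~q′ e≡e′ ¬ram)) (SF.sym p′~q′)))
        where
        e≡e′ : e ≡ e′
        e≡e′ = simple-faces _ _ (trans (sym d∼e) (trans (cong RF.label d≡d′) d′∼e′)) e∼e′
      ... | no ¬ramF | yes ramd | yes rame = inj₂ (inj₁ (SV.reflexive
              (LF.unramified-≡ p~q (vertices-apart _ _ d∼e ramd rame) ¬ramF)))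

      -- The dual of `same-corner`, with vertices and faces exchanged.
      same-vertex : d ≡ e → Meeting p p′ q q′
      same-vertex d≡e
        with ramified? (RV.label d) | ramified? (RF.label d) | ramified? (RF.label d′)
      ... | yes ramV | _ | _ = inj₂ (inj₁ (LV.ramified-≈ ramV (cong RV.label d≡e)))
      ... | no _ | no ¬ram | _ = inj₂ (inj₁ (SV.reflexive (LF.unramified-≡ p~q d≡e ¬ram)))
      ... | no _ | yes _ | no ¬ram = inj₂ (inj₁ (SV.trans p~p′ (SV.trans
              (SV.reflexive (LF.unramified-≡ p′~q′ d′≡e′ ¬ram)) (SV.sym q~q′))))
        where
        d′≡e′ : d′ ≡ e′
        d′≡e′ = simple-faces _ _ d′∼e′ (trans (sym d∼d′) (trans (cong RV.label d≡e) e∼e′))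
      ... | no _ | yes ramd | yes ramd′ =
              inj₁ (LF.ramified-≈ ramd (cong RF.label (faces-apart _ _ d∼d′ ramd ramd′)))

      -- Of the two vertices and the two faces at the common edge, at most one
      -- is ramified, and the other three determine the sheets of all corners.
      module _ (e′≡αd : e′ ≡ B.α d) where

        via-face : ¬ RamifiedFace d → ¬ RamifiedVertex e → q′ ≡ α p
        via-face ¬ramd ¬rame = sym (LV.unramified-≡ αp~q′ (sym e′≡αd)
          (¬rame ∘ subst Ramified (sym e∼αd)))
          where
          e∼αd : e ∼ᵛ B.α d
          e∼αd = trans e∼e′ (cong RV.label e′≡αd)

          nd≡e : next B d ≡ e
          nd≡e = simple-faces _ _ (trans (RF.label-p d) d∼e)
                   (trans (RV.label-p (B.α d)) (sym e∼αd))

          np≡q : next cover p ≡ q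
          np≡q = LF.unramified-≡ (SF.trans (SF.sym (next-same cover p)) p~q) nd≡e
                   (¬ramd ∘ subst Ramified (RF.label-p d))

          αp~q′ : SameVertex (α p) q′
          αp~q′ = SV.trans (α-next cover p) (SV.trans (SV.reflexive np≡q) q~q′)

        via-vertex : ¬ RamifiedVertex d → ¬ RamifiedFace d′ → q′ ≡ α p
        via-vertex ¬ramd ¬ramd′ = sym (LF.unramified-≡ αp~q′ (sym e′≡αd)
          (¬ramd′ ∘ subst Ramified (sym d′∼αd)))
          where
          d′∼αd : d′ ∼ᶠ B.α d
          d′∼αd = trans d′∼e′ (cong RF.label e′≡αd)

          αd∼rd : B.α d ∼ᶠ B.rot d
          αd∼rd = trans (sym (RF.label-p (B.α d)))
                        (cong (RF.label ∘ B.rot) (B.α-involutive d))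

          rd≡d′ : B.rot d ≡ d′
          rd≡d′ = simple-faces _ _ (trans (sym αd∼rd) (sym d′∼αd)) (trans (RV.label-p d) d∼d′)

          rp≡p′ : rot p ≡ p′
          rp≡p′ = LV.unramified-≡ (SV.trans (SV.sym (rot-same cover p)) p~p′) rd≡d′
                    (¬ramd ∘ subst Ramified (RV.label-p d))

          αp~q′ : SameFace (α p) q′
          αp~q′ = SF.trans (next-same cover (α p))
            (SF.trans (SF.reflexive (trans (cong rot (α-involutive p)) rp≡p′)) p′~q′)

        common-edge : Meeting p p′ q q′
        common-edge
          with ramified? (RF.label d) | ramified? (RF.label d′)
             | ramified? (RV.label d) | ramified? (RV.label e)
        ... | yes ramd | yes ramd′ | _ | _ =
              inj₁ (LF.ramified-≈ ramd (cong RF.label (faces-apart _ _ d∼d′ ramd ramd′)))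
        ... | _ | _ | yes ramd | yes rame =
              inj₂ (inj₁ (LV.ramified-≈ ramd (cong RV.label (vertices-apart _ _ d∼e ramd rame))))
        ... | no ¬ramd | _ | _ | no ¬rame = inj₂ (inj₂ (inj₁ (via-face ¬ramd ¬rame)))
        ... | _ | no ¬ramd′ | no ¬ramd | _ = inj₂ (inj₂ (inj₁ (via-vertex ¬ramd ¬ramd′)))
        -- What remains is a ramified vertex incident with a ramified face, at the corner `d` here
        -- and at `e′` in the last case.
        ... | yes ramF | no _ | yes ramV | no _ = contradiction ramF (not-both d ramV)
        ... | no _ | yes ramF | no _ | yes ramV = contradiction
              (subst Ramified d′∼e′ ramF) (not-both e′ (subst Ramified e∼e′ ramV))

  meeting-swap : ∀ {p p′ q q′} → SameFace p q → SameFace p′ q′ →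
                 Meeting q q′ p p′ → Meeting p p′ q q′
  meeting-swap p~q p′~q′ (inj₁ q~q′) = inj₁ (SF.trans p~q (SF.trans q~q′ (SF.sym p′~q′)))
  meeting-swap _ _ (inj₂ (inj₁ q~p)) = inj₂ (inj₁ (SV.sym q~p))
  meeting-swap _ _ (inj₂ (inj₂ (inj₁ p′≡αq))) = inj₂ (inj₂ (inj₂ p′≡αq))
  meeting-swap _ _ (inj₂ (inj₂ (inj₂ q′≡αp))) = inj₂ (inj₂ (inj₁ q′≡αp))

  cover-proper : ProperIntersections cover
  cover-proper p~p′ q~q′ p~q p′~q′
    with proper _ _ (LV.≈⇒∼ p~p′) _ (LF.≈⇒∼ p~q) _ (LV.≈⇒∼ q~q′) (LF.≈⇒∼ p′~q′)
  ... | inj₁ d≡d′ = same-corner p~p′ q~q′ p~q p′~q′ d≡d′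
  ... | inj₂ (inj₁ d≡e) = same-vertex p~p′ q~q′ p~q p′~q′ d≡e
  ... | inj₂ (inj₂ (inj₁ e′≡αd)) = common-edge p~p′ q~q′ p~q p′~q′ e′≡αd
  ... | inj₂ (inj₂ (inj₂ d′≡αe)) = meeting-swap p~q p′~q′
        (common-edge q~q′ p~p′ (SF.sym p~q) (SF.sym p′~q′) d′≡αe)

  _≟ᴵ_ : DecidableEquality I
  _≟ᴵ_ = via-injection (↔⇒↣ I-finite) Fin._≟_

  cover-isLocallyPolyhedral : IsLocallyPolyhedral cover
  cover-isLocallyPolyhedral = record
    { simple      = cover-isSimple
    ; simpleFaces = cover-simpleFaces
    ; proper      = cover-proper
    ; no-leaf     = λ (_ , d) eq → no-leaf d (cong proj₂ eq)
    ; no-digon    = λ (_ , d) eq → no-digon d (cong proj₂ eq)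
    ; _~ᵛ?_       = LV._≈?_ _≟ᴵ_
    ; _~ᶠ?_       = LF._≈?_ _≟ᴵ_
    }

  cover-isPolyhedral : 4 ≤ u → IsPolyhedral cover
  cover-isPolyhedral 4≤u = locallyPolyhedral⇒polyhedral cover cover-isLocallyPolyhedral record
    { to        = corner
    ; cong      = λ { refl → SV.refl }
    ; injective = λ same → Fin.inject≤-injective 4≤u 4≤u _ _ (Sum.inj₂-injective
        (trans (sym (RV.label-root _)) (trans (LV.≈⇒∼ same) (RV.label-root _))))
    }
    where
    corner : Fin 4 → Dart
    corner v = i₀ , RV.root (inj₂ (inject≤ v 4≤u))

  label-count : ∀ b u → (Fin b ⊎ (I × Fin u)) ↔ Fin (b + m * u)
  label-count b u = ↔-sym Fin.+↔⊎ ↔-∘ (↔-id _ ⊎-↔ (↔-sym Fin.*↔× ↔-∘ (I-finite ×-↔ ↔-id _)))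

  vertex-count : HasCardinality Vertices (b + m * u)
  vertex-count = inverse (LV.labels i₀) (label-count b u)

  face-count : HasCardinality Faces (b + m * u)
  face-count = inverse (LF.labels i₀) (label-count b u)

  edge-count : HasCardinality Edges (0 + m * k)
  edge-count = inverse (LE.labels i₀) (label-count 0 k)

  -- The third hypothesis makes corresponding shifts exactly opposite, so the duality lifts with the
  -- identity on sheets.
  cover-selfDual : (δ : B.Dart ↔ B.Dart) → let δ⁺ = Inverse.to δ in
    (∀ d → δ⁺ (B.α d) ≡ B.α (δ⁺ d)) →
    (∀ d → next B (δ⁺ (B.rot d)) ≡ δ⁺ d) →
    (∀ d → s (B.α (δ⁺ (B.rot d))) ℤ.+ s d ≡ 0ℤ) →
    SelfDual cover
  cover-selfDual δ δ-α δ-rot δ-s = record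
    { bijection    = ↔-id _ ×-↔ δ
    ; α-compatible = λ (i , d) → cong (i ,_) (δ-α d)
    ; σ-compatible = inj₂ λ (i , d) → cong₂ _,_
        (·-inverse {s (B.α (Inverse.to δ (B.rot d)))} (δ-s d) i) (δ-rot d)
    }

-- Orbit data by computation

stepsTo : ∀ {n} → ℕ → (Fin n → Fin n) → Fin n → Fin n → ℕ
-- The default value is harmless: every count is checked by iterating, and fewer than `n` steps
-- suffice in `Fin n`.
stepsTo zero       p r d = 0
stepsTo (suc fuel) p r d = if does (d Fin.≟ r) then 0 else suc (stepsTo fuel p r (p d))

module _ {b u : ℕ} where

  infix 4 _≟ˡ_
  _≟ˡ_ : DecidableEquality (Fin b ⊎ Fin u)
  _≟ˡ_ = Sum.≡-dec Fin._≟_ Fin._≟_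

  module Tabulated {n : ℕ} (p : Fin n → Fin n) (s : Fin n → ℤ)
    (label : Fin n → Fin b ⊎ Fin u) (root : Fin b ⊎ Fin u → Fin n) where

    steps : Fin n → ℕ
    steps d = stepsTo n p (root (label d)) d

    height : Fin n → ℤ
    height d = proj₁ (iterate (shift p s) (0ℤ , d) (steps d))

    private
      _≟ˢ_ : DecidableEquality (ℤ × Fin n)
      _≟ˢ_ = Product.≡-dec ℤ._≟_ Fin._≟_

    label-p? = Fin.all? λ d → label (p d) ≟ˡ label d
    label-root₁? = Fin.all? λ w → label (root (inj₁ w)) ≟ˡ inj₁ w
    label-root₂? = Fin.all? λ w → label (root (inj₂ w)) ≟ˡ inj₂ w
    reaches-root? = Fin.all? λ d → iterate p d (steps d) Fin.≟ root (label d)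
    height-p? = Fin.all? λ d → ramified? (label d) ⊎-dec height (p d) ℤ.+ s d ℤ.≟ height d
    height-root? = Fin.all? λ w → height (root (inj₂ w)) ℤ.≟ 0ℤ
    -- The length of an orbit lies between 1 and `n`, hence `suc (toℕ k)`.
    monodromy? = Fin.all? λ w → let r = root (inj₁ w) in Fin.any? λ (k : Fin n) →
      let end = iterate (shift p s) (0ℤ , r) (suc (toℕ k)) in
      (end ≟ˢ (1ℤ , r)) ⊎-dec (end ≟ˢ (-1ℤ , r))

    ramification : {t₁ : True label-p?} {t₂ : True label-root₁?} {t₃ : True label-root₂?}
      {t₄ : True reaches-root?} {t₅ : True height-p?} {t₆ : True height-root?}
      {t₇ : True monodromy?} → Ramification p s b u
    ramification {t₁} {t₂} {t₃} {t₄} {t₅} {t₆} {t₇} = record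
      { label        = label
      ; root         = root
      ; height       = height
      ; label-p      = toWitness t₁
      ; label-root   = λ { (inj₁ w) → toWitness t₂ w ; (inj₂ w) → toWitness t₃ w }
      ; reaches-root = λ d → steps d , toWitness t₄ d
      ; height-p     = toWitness t₅
      ; height-root  = toWitness t₆
      ; monodromy    = λ w → let k , eq = toWitness t₇ w in suc (toℕ k) , eq
      }

-- The base polyhedron

Dart₂₈ : Set
Dart₂₈ = Fin 28

-- All entries are less than the modulus, here and below.
table : Vec ℕ 28 → Dart₂₈ → Dart₂₈
table t d = lookup t d mod 28

-- A polyhedron with 8 vertices, the darts at each vertex having consecutive
-- numbers, and an orientation-reversing duality δ₀.
σ₀ σ₀⁻¹ α₀ δ₀ δ₀⁻¹ : Dart₂₈ → Dart₂₈
σ₀ = table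
  ( 1 ∷ 2 ∷ 0 ∷ 4 ∷ 5 ∷ 3 ∷ 7 ∷ 8 ∷ 6 ∷ 10 ∷ 11 ∷ 9 ∷ 13 ∷ 14 ∷ 15 ∷ 16 ∷ 12
  ∷ 18 ∷ 19 ∷ 17 ∷ 21 ∷ 22 ∷ 23 ∷ 24 ∷ 20 ∷ 26 ∷ 27 ∷ 25 ∷ [])
σ₀⁻¹ = table
  ( 2 ∷ 0 ∷ 1 ∷ 5 ∷ 3 ∷ 4 ∷ 8 ∷ 6 ∷ 7 ∷ 11 ∷ 9 ∷ 10 ∷ 16 ∷ 12 ∷ 13 ∷ 14 ∷ 15
  ∷ 19 ∷ 17 ∷ 18 ∷ 24 ∷ 20 ∷ 21 ∷ 22 ∷ 23 ∷ 27 ∷ 25 ∷ 26 ∷ [])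
α₀ = table
  ( 10 ∷ 20 ∷ 14 ∷ 26 ∷ 16 ∷ 23 ∷ 9 ∷ 12 ∷ 17 ∷ 6 ∷ 0 ∷ 13 ∷ 7 ∷ 11 ∷ 2 ∷ 24 ∷ 4
  ∷ 8 ∷ 25 ∷ 21 ∷ 1 ∷ 19 ∷ 27 ∷ 5 ∷ 15 ∷ 18 ∷ 3 ∷ 22 ∷ [])
δ₀ = table
  ( 13 ∷ 7 ∷ 9 ∷ 22 ∷ 19 ∷ 25 ∷ 2 ∷ 20 ∷ 15 ∷ 14 ∷ 11 ∷ 0 ∷ 1 ∷ 10 ∷ 6 ∷ 17 ∷ 21
  ∷ 24 ∷ 5 ∷ 16 ∷ 12 ∷ 4 ∷ 26 ∷ 18 ∷ 8 ∷ 23 ∷ 27 ∷ 3 ∷ [])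
δ₀⁻¹ = table
  ( 11 ∷ 12 ∷ 6 ∷ 27 ∷ 21 ∷ 18 ∷ 14 ∷ 1 ∷ 24 ∷ 2 ∷ 13 ∷ 10 ∷ 20 ∷ 0 ∷ 9 ∷ 8 ∷ 19
  ∷ 15 ∷ 23 ∷ 4 ∷ 7 ∷ 16 ∷ 3 ∷ 25 ∷ 17 ∷ 5 ∷ 22 ∷ 26 ∷ [])

-- In terms of corners, the nonzero shifts form two paths v – G – w – F from a
-- ramified vertex v to a ramified face F.  Their signs alternate along a path,
-- so they cancel at G and w.
s₀ : Dart₂₈ → ℤ
s₀ = lookup
  ( + 1 ∷ + 0 ∷ + 0 ∷ -[1+ 0 ] ∷ + 0 ∷ + 0 ∷ + 0 ∷ + 0 ∷ + 0 ∷ + 0 ∷ + 0 ∷ + 0 ∷ -[1+ 0 ] ∷ + 0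
  ∷ + 0 ∷ + 0 ∷ + 1 ∷ + 0 ∷ + 0 ∷ + 0 ∷ -[1+ 0 ] ∷ + 1 ∷ + 0 ∷ + 0 ∷ + 0 ∷ + 0 ∷ + 0 ∷ + 0 ∷ [])

-- A step along a spanning tree of the darts towards dart 0: 1 stands for α₀.
toward₀ : Dart₂₈ → Dart₂₈
toward₀ d with lookup
  (0 ∷ 0 ∷ 0 ∷ 0 ∷ 1 ∷ 1 ∷ 1 ∷ 1 ∷ 0 ∷ 0 ∷ 1 ∷ 0 ∷ 0 ∷ 0 ∷ 1 ∷ 1 ∷ 0 ∷ 1 ∷ 0 ∷ 0
  ∷ 1 ∷ 0 ∷ 0 ∷ 0 ∷ 0 ∷ 1 ∷ 0 ∷ 1 ∷ []) d
... | zero  = σ₀ d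
... | suc _ = α₀ d

permutation : ∀ {n} (f g : Fin n → Fin n) →
  {t : True (Fin.all? λ d → f (g d) Fin.≟ d)} →
  {t′ : True (Fin.all? λ d → g (f d) Fin.≟ d)} → Fin n ↔ Fin n
permutation f g {t} {t′} = mk↔ₛ′ f g (toWitness t) (toWitness t′)

base : Map
base = record
  { Dart         = Dart₂₈
  ; size         = 28
  ; finite       = ↔-id _
  ; σ            = permutation σ₀ σ₀⁻¹
  ; α            = α₀
  ; α-involutive = from-yes (Fin.all? λ d → α₀ (α₀ d) Fin.≟ d)
  ; α-free       = from-yes (Fin.all? λ d → ¬? (α₀ d Fin.≟ d))
  ; connected    = λ d e → to-zero d ◅◅ EqC.symmetric _ (to-zero e)
  }
  where
  Link : Dart₂₈ → Dart₂₈ → Set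
  Link x y = σ₀ x ≡ y ⊎ α₀ x ≡ y

  toward-link : ∀ d → Link d (toward₀ d)
  toward-link = from-yes (Fin.all? λ d → (σ₀ d Fin.≟ toward₀ d) ⊎-dec (α₀ d Fin.≟ toward₀ d))

  to-zero : ∀ d → EqClosure Link d zero
  to-zero d = subst (EqClosure Link d)
    (from-yes (Fin.all? λ d → iterate toward₀ d (stepsTo 28 toward₀ zero d) Fin.≟ zero) d)
    (EqC.map (λ { {x} refl → toward-link x }) (iterate-orbit toward₀ (stepsTo 28 toward₀ zero d) d))

module _ where
  open Map base

  -- Cells are numbered so that 0 and 1 are the ramified ones, which `splitAt 2` separates from the
  -- rest.
  vertexOf faceOf : Dart₂₈ → Fin 2 ⊎ Fin 6
  vertexOf d = splitAt 2 (lookup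
    (0 ∷ 0 ∷ 0 ∷ 1 ∷ 1 ∷ 1 ∷ 2 ∷ 2 ∷ 2 ∷ 3 ∷ 3 ∷ 3 ∷ 4 ∷ 4 ∷ 4 ∷ 4 ∷ 4 ∷ 5 ∷ 5 ∷ 5
    ∷ 6 ∷ 6 ∷ 6 ∷ 6 ∷ 6 ∷ 7 ∷ 7 ∷ 7 ∷ []) d mod 8)
  faceOf d = splitAt 2 (lookup
    (4 ∷ 2 ∷ 5 ∷ 6 ∷ 3 ∷ 7 ∷ 2 ∷ 1 ∷ 3 ∷ 1 ∷ 2 ∷ 4 ∷ 3 ∷ 1 ∷ 4 ∷ 5 ∷ 7 ∷ 2 ∷ 3 ∷ 0
    ∷ 5 ∷ 2 ∷ 0 ∷ 6 ∷ 7 ∷ 0 ∷ 3 ∷ 6 ∷ []) d mod 8)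

  edgeOf : Dart₂₈ → Fin 0 ⊎ Fin 14
  edgeOf d = inj₂ (lookup
    (0 ∷ 1 ∷ 2 ∷ 3 ∷ 4 ∷ 5 ∷ 6 ∷ 7 ∷ 8 ∷ 6 ∷ 0 ∷ 9 ∷ 7 ∷ 9 ∷ 2 ∷ 10 ∷ 4 ∷ 8 ∷ 11 ∷ 12
    ∷ 1 ∷ 12 ∷ 13 ∷ 5 ∷ 10 ∷ 11 ∷ 3 ∷ 13 ∷ []) d mod 14)

  dartAt : ∀ {b u} → Vec ℕ b → Vec ℕ u → Fin b ⊎ Fin u → Dart₂₈
  dartAt ram unram = [ (λ w → lookup ram w mod 28) , (λ w → lookup unram w mod 28) ]′

  vertices : Ramification rot s₀ 2 6
  vertices = Tabulated.ramification rot s₀ vertexOf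
    (dartAt (0 ∷ 3 ∷ []) (6 ∷ 9 ∷ 12 ∷ 17 ∷ 20 ∷ 25 ∷ []))

  faces : Ramification (next base) (s₀ ∘ α) 2 6
  faces = Tabulated.ramification (next base) (s₀ ∘ α) faceOf
    (dartAt (19 ∷ 7 ∷ []) (1 ∷ 4 ∷ 0 ∷ 2 ∷ 3 ∷ 5 ∷ []))

  edges : Ramification α (λ _ → 0ℤ) 0 14
  edges = Tabulated.ramification α (λ _ → 0ℤ) edgeOf
    (dartAt [] (0 ∷ 1 ∷ 2 ∷ 3 ∷ 4 ∷ 5 ∷ 6 ∷ 7 ∷ 8 ∷ 11 ∷ 15 ∷ 18 ∷ 19 ∷ 22 ∷ []))

  basePolyhedron : RamifiedPolyhedron base s₀ 2 6 14
  basePolyhedron = record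
    { V = vertices
    ; F = faces
    ; E = edges
    ; loopless = from-yes (Fin.all? λ d → ¬? (d ≟ᵛ α d))
    ; no-parallels = from-yes (Fin.all? λ d → Fin.all? λ e →
        (d ≟ᵛ e) →-dec ((α d ≟ᵛ α e) →-dec (d Fin.≟ e)))
    ; simple-faces = from-yes (Fin.all? λ d → Fin.all? λ e →
        (d ≟ᶠ e) →-dec ((d ≟ᵛ e) →-dec (d Fin.≟ e)))
    -- Testing each relation as soon as its darts are chosen prunes the search through all
    -- quadruples of darts.
    ; proper = from-yes (
        Fin.all? λ p → Fin.all? λ p′ → (p ≟ᵛ p′) →-dec
        (Fin.all? λ q → (p ≟ᶠ q) →-dec
        (Fin.all? λ q′ → (q ≟ᵛ q′) →-dec ((p′ ≟ᶠ q′) →-dec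
          ((p Fin.≟ p′) ⊎-dec (p Fin.≟ q) ⊎-dec (q′ Fin.≟ α p) ⊎-dec (p′ Fin.≟ α q))))))
    ; no-leaf = from-yes (Fin.all? λ d → ¬? (rot d Fin.≟ d))
    ; no-digon = from-yes (Fin.all? λ d → ¬? (next base (next base d) Fin.≟ d))
    ; faces-apart = from-yes (Fin.all? λ d → Fin.all? λ e →
        (d ≟ᵛ e) →-dec (ramified? (faceOf d) →-dec (ramified? (faceOf e) →-dec (d Fin.≟ e))))
    ; vertices-apart = from-yes (Fin.all? λ d → Fin.all? λ e →
        (d ≟ᶠ e) →-dec (ramified? (vertexOf d) →-dec (ramified? (vertexOf e) →-dec (d Fin.≟ e))))
    ; not-both = from-yes (Fin.all? λ d → ramified? (vertexOf d) →-dec ¬? (ramified? (faceOf d)))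
    }
    where
    _≟ᵛ_ = λ d e → vertexOf d ≟ˡ vertexOf e
    _≟ᶠ_ = λ d e → faceOf d ≟ˡ faceOf e

theorem2 : (g : ℕ) → ∃[ M ] (IsPolyhedral M × SelfDual M × HasGenus g M)
theorem2 g =
    cover
  , cover-isPolyhedral (s≤s (s≤s (s≤s (s≤s z≤n))))
  , cover-selfDual (permutation δ₀ δ₀⁻¹)
      (from-yes (Fin.all? λ d → δ₀ (α₀ d) Fin.≟ α₀ (δ₀ d)))
      (from-yes (Fin.all? λ d → next base (δ₀ (σ₀ d)) Fin.≟ δ₀ d))
      (from-yes (Fin.all? λ d → s₀ (α₀ (δ₀ (σ₀ d))) ℤ.+ s₀ d ℤ.≟ 0ℤ))
  , _ , _ , _ , vertex-count , edge-count , face-count , euler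
  where
  open Cover basePolyhedron zero (↔-id (Fin (suc g))) (cycle g) (cycle-transitive g) zero
  open +-*-Solver

  euler : (2 + suc g * 6) + (2 + suc g * 6) + 2 * g ≡ suc g * 14 + 2
  euler = solve 1 (λ g →
    let m = con 1 :+ g in
    (con 2 :+ m :* con 6) :+ (con 2 :+ m :* con 6) :+ con 2 :* g := m :* con 14 :+ con 2) refl g
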